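{- Suppose $\vec K$-$\mathsf{SCFA}$ holds for some adequate model sequence $\vec K$. Then $\mathsf{SCFA}$ holds.
   Context: **Models.** $\mathcal L_{\mathrm{ST}}=\{\in\}$ and $\mathcal L_{\mathrm{ST}}^+=\{\in,\tilde P\}$ with $\tilde P$ a unary predicate. $\mathrm{ZF}^-$, $\mathrm{ZFC}^-$ are $\mathrm{ZF}$, $\mathrm{ZFC}$ without Power Set (for $\mathcal L_{\mathrm{ST}}^+$-structures, Separation and Replacement are for all $\mathcal L_{\mathrm{ST}}^+$-formulas). Structures are identified with their universes; a structure is transitive if its universe is a transitive set and its membership relation is the true $\in$. $\sigma:M\prec N$ means $\sigma$ is an elementary embedding of $M$ into $N$. For a set $A$ and ordinal $\chi$, $L^A_\chi=\langle L_\chi[A],\in,A\cap L_\chi[A]\rangle$. A transitive $\mathcal L_{\mathrm{ST}}^+$-model $M$ of $\mathrm{ZFC}^-$ is *full* if there is a transitive $\mathcal L_{\mathrm{ST}}$-model $N$ of $\mathrm{ZF}^-$ with $M\in N$ such that for all $x\in M$ and all $f:x\to M$ with $f\in N$ we have $f\in M$. **Model sequences.** $\vec K=\langle K_\xi\mid\xi<\omega_1\rangle$ is an *adequate model sequence* if (i) each $K_\xi$ is a transitive (set) $\mathcal L_{\mathrm{ST}}$-model of $\mathrm{ZFC}^-$, $\xi\in K_\xi$ and $\xi$ is countable in $K_\xi$; (ii) for every $B\subseteq\omega_1$ there are stationarily many $\xi<\omega_1$ with $B\cap\xi\in K_\xi$. A *$\vec K$-good model* is a transitive full $\mathcal L_{\mathrm{ST}}^+$-model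 $\bar M$ of $\mathrm{ZFC}^-$ such that $\bar M\in K_{\omega_1^{\bar M}}$ and $\bar M$ is countable in $K_{\omega_1^{\bar M}}$. **$\vec K$-subcompleteness.** A forcing notion is a separative preorder with a largest element. A regular cardinal $\theta$ and $a\in\mathcal H_\theta$ *verify the $\vec K$-subcompleteness* of a forcing notion $\mathbb P$ if $\mathbb P\in\mathcal H_\theta$ and for all $A,\chi,\bar M,\bar{\mathbb P},\bar b,\sigma,b,\bar G$: if (i) $A$ is a set, $\chi$ is an ordinal, $\mathcal H_\theta\subseteq L^A_\chi\models\mathrm{ZFC}^-$; (ii) $\bar M$ is a $\vec K$-good model with $\bar{\mathbb P},\bar b\in\bar M$; (iii) $\sigma:\bar M\prec L^A_\chi$, $a\in\mathrm{ran}(\sigma)$, $\sigma(\langle\bar{\mathbb P},\bar b\rangle)=\langle\mathbb P,b\rangle$; (iv) $\bar G$ is a $\bar{\mathbb P}$-generic filter over $\bar M$ with $\bar G\in K_{\omega_1^{\bar M}}$; then there is $p^*\in\mathbb P$ forcing that there is $\sigma^*:\bar M\prec L^A_\chi$ with $\sigma^*(\langle\bar{\mathbb P},\bar b\rangle)=\langle\mathbb P,b\rangle$ and $\sigma^*[\bar G]\subseteq\dot G$, where $\dot G$ is the canonical name for the generic filter. $\mathbb P$ is *$\vec K$-subcomplete* if some regular $\theta$ and $a\in\mathcal H_\theta$ verify this. **Subcompleteness (Jensen).** For a forcing notion $\mathbb P$ let $\delta(\mathbb P)$ be the least cardinality of a dense subset of $\mathbb P$; for $M=L^A_\chi\models\mathrm{ZFC}^-$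 and $X\subseteq M$ let $\mathrm{Hull}^M(X)$ be the Skolem hull of $X$ in $M$, i.e. the set of elements of $M$ definable in $M$ from parameters in $X$. $\mathbb P$ is *subcomplete* if there are a regular cardinal $\theta$ and $a\in\mathcal H_\theta$ with $\mathbb P\in\mathcal H_\theta$ such that for all $A,\chi,\bar M,\bar{\mathbb P},\bar b,\sigma,b,\bar G$: if $A$ is a set, $\chi$ is an ordinal, $\mathcal H_\theta\subseteq M:=L^A_\chi\models\mathrm{ZFC}^-$; $\bar M$ is a countable transitive full $\mathcal L^+_{\mathrm{ST}}$-model of $\mathrm{ZFC}^-$ with $\bar{\mathbb P},\bar b\in\bar M$; $\sigma:\bar M\prec M$, $a\in\mathrm{ran}(\sigma)$, $\sigma(\langle\bar{\mathbb P},\bar b\rangle)=\langle\mathbb P,b\rangle$; and $\bar G$ is a $\bar{\mathbb P}$-generic filter over $\bar M$; then there is $p^*\in\mathbb P$ forcing that there is $\sigma^*:\bar M\prec M$ with $\sigma^*(\langle\bar{\mathbb P},\bar b\rangle)=\langle\mathbb P,b\rangle$, $\sigma^*[\bar G]\subseteq\dot G$ and $\mathrm{Hull}^M(\delta(\mathbb P)\cup\mathrm{ran}(\sigma^*))=\mathrm{Hull}^M(\delta(\mathbb P)\cup\mathrm{ran}(\sigma))$. **Forcing axioms.** $\mathsf{SCFA}$ (respectively $\vec K$-$\mathsf{SCFA}$, for an adequate model sequence $\vec K$): for any subcomplete (respectively $\vec K$-subcomplete) forcing notion $\mathbb P$ and any family $\mathcal D$ of dense subsets of $\mathbb P$ with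 $|\mathcal D|\le\omega_1$, there is a filter $g$ on $\mathbb P$ with $g\cap D\ne\emptyset$ for all $D\in\mathcal D$. -}

module Defs where

open import Level using (Level; suc)
open import Data.Empty.Polymorphic using () renaming (⊥ to Empty-type)
open import Data.Fin.Base using (Fin)
open import Data.Nat.Base using (ℕ) renaming (zero to 0ℕ; suc to 1+_)
open import Data.Product.Base using (_×_; ∃)
open import Data.Sum.Base using (_⊎_)
open import Data.Vec.Base using (Vec; _∷_; lookup)
open import Relation.Binary.PropositionalEquality.Core using (_≡_)

private
  variable
    ℓ : Level
    X : Set ℓ
    n : ℕ

infix  8 _∈_ _≐_
infix  7 ¬_
infixr 6 _∧_
infixr 5 _∨_
infixr 4 _⇒_
infix  3 _⇔_

-- Formulas with parameters from X, with binders in higher-order abstract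
-- syntax.  Every set-theoretic notion below is written once, for an
-- arbitrary X, so it is a single first-order formula; it can be evaluated
-- in a structure, relativised to a set, and forced.

data Formula (X : Set ℓ) : Set ℓ where
  _∈_ _≐_     : X → X → Formula X
  ⊥           : Formula X
  _∧_ _∨_ _⇒_ : Formula X → Formula X → Formula X
  ∀∀ ∃∃       : (X → Formula X) → Formula X

Class : Set ℓ → Set ℓ
Class X = X → Formula X

⊤ : Formula X
⊤ = ⊥ ⇒ ⊥

¬_ : Formula X → Formula X
¬ φ = φ ⇒ ⊥

_⇔_ : Formula X → Formula X → Formula X
φ ⇔ ψ = (φ ⇒ ψ) ∧ (ψ ⇒ φ)

∀∈ ∃∈ : X → Class X → Formula X
∀∈ a φ = ∀∀ λ x → x ∈ a ⇒ φ x
∃∈ a φ = ∃∃ λ x → x ∈ a ∧ φ x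

∃! : Class X → Formula X
∃! φ = ∃∃ λ x → φ x ∧ (∀∀ λ y → φ y ⇒ y ≐ x)

_⊧_ : {X : Set ℓ} → (X → X → Set ℓ) → Formula X → Set ℓ
E ⊧ (x ∈ y) = E x y
E ⊧ (x ≐ y) = x ≡ y
E ⊧ ⊥       = Empty-type
E ⊧ (φ ∧ ψ) = (E ⊧ φ) × (E ⊧ ψ)
E ⊧ (φ ∨ ψ) = (E ⊧ φ) ⊎ (E ⊧ ψ)
E ⊧ (φ ⇒ ψ) = (E ⊧ φ) → (E ⊧ ψ)
E ⊧ (∀∀ φ)  = ∀ x → E ⊧ φ x
E ⊧ (∃∃ φ)  = ∃ λ x → E ⊧ φ x

-- Relativisation.  For a transitive set M, φ ^ M says ⟨M,∈⟩ ⊨ φ.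

_^_ : Formula X → X → Formula X
(x ∈ y) ^ M = x ∈ y
(x ≐ y) ^ M = x ≐ y
⊥       ^ M = ⊥
(φ ∧ ψ) ^ M = (φ ^ M) ∧ (ψ ^ M)
(φ ∨ ψ) ^ M = (φ ^ M) ∨ (ψ ^ M)
(φ ⇒ ψ) ^ M = (φ ^ M) ⇒ (ψ ^ M)
(∀∀ φ)  ^ M = ∀∈ M λ x → φ x ^ M
(∃∃ φ)  ^ M = ∃∈ M λ x → φ x ^ M

-- These index the axiom schemes of the ambient theory.  Functions into
-- Formula X would not do: they are not restricted to first-order conditions.

data Fml (n : ℕ) : Set where
  _∈_ _≐_     : Fin n → Fin n → Fml n
  ⊥           : Fml n
  _∧_ _∨_ _⇒_ : Fml n → Fml n → Fml n
  ∀∀ ∃∃       : Fml (1+ n) → Fml n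

_⟪_⟫ : Fml n → Vec X n → Formula X
(i ∈ j) ⟪ ρ ⟫ = lookup ρ i ∈ lookup ρ j
(i ≐ j) ⟪ ρ ⟫ = lookup ρ i ≐ lookup ρ j
⊥       ⟪ ρ ⟫ = ⊥
(φ ∧ ψ) ⟪ ρ ⟫ = (φ ⟪ ρ ⟫) ∧ (ψ ⟪ ρ ⟫)
(φ ∨ ψ) ⟪ ρ ⟫ = (φ ⟪ ρ ⟫) ∨ (ψ ⟪ ρ ⟫)
(φ ⇒ ψ) ⟪ ρ ⟫ = (φ ⟪ ρ ⟫) ⇒ (ψ ⟪ ρ ⟫)
(∀∀ φ)  ⟪ ρ ⟫ = ∀∀ λ x → φ ⟪ x ∷ ρ ⟫
(∃∃ φ)  ⟪ ρ ⟫ = ∃∃ λ x → φ ⟪ x ∷ ρ ⟫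

_⊆_ : X → X → Formula X
a ⊆ b = ∀∈ a λ x → x ∈ b

IsEmpty : X → Formula X
IsEmpty a = ∀∀ λ x → ¬ (x ∈ a)

_≐｛_,_｝ : X → X → X → Formula X
z ≐｛ a , b ｝ = ∀∀ λ x → x ∈ z ⇔ x ≐ a ∨ x ≐ b

_≐⟨_,_⟩ : X → X → X → Formula X
z ≐⟨ a , b ⟩ =
  ∃∃ λ u → ∃∃ λ v → (u ≐｛ a , a ｝) ∧ (v ≐｛ a , b ｝) ∧ (z ≐｛ u , v ｝)

⟨_,_⟩∈_ : X → X → X → Formula X
⟨ a , b ⟩∈ f = ∃∈ f λ z → z ≐⟨ a , b ⟩

⟨_,_,_⟩∈_ : X → X → X → X → Formula X
⟨ a , b , c ⟩∈ f = ∃∃ λ d → (d ≐⟨ b , c ⟩) ∧ (⟨ a , d ⟩∈ f)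

_≐_∩_ : X → X → X → Formula X
c ≐ a ∩ b = ∀∀ λ x → x ∈ c ⇔ x ∈ a ∧ x ∈ b

FunctionOn : X → X → Formula X
FunctionOn f a =
  (∀∈ f λ z → ∃∈ a λ x → ∃∃ λ y → z ≐⟨ x , y ⟩) ∧
  (∀∈ a λ x → ∃! λ y → ⟨ x , y ⟩∈ f)

_∶_⟶_ : X → X → X → Formula X
f ∶ a ⟶ b = FunctionOn f a ∧ (∀∀ λ x → ∀∀ λ y → ⟨ x , y ⟩∈ f ⇒ y ∈ b)

Injection : X → X → X → Formula X
Injection f a b =
  (f ∶ a ⟶ b) ∧
  (∀∀ λ x → ∀∀ λ x′ → ∀∀ λ y → ⟨ x , y ⟩∈ f ⇒ ⟨ x′ , y ⟩∈ f ⇒ x ≐ x′)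

Bijection : X → X → X → Formula X
Bijection f a b = Injection f a b ∧ (∀∈ b λ y → ∃∈ a λ x → ⟨ x , y ⟩∈ f)

Transitive : X → Formula X
Transitive a = ∀∈ a λ x → x ⊆ a

Ordinal : X → Formula X
Ordinal α =
  Transitive α ∧ (∀∈ α λ x → ∀∈ α λ y → x ∈ y ∨ x ≐ y ∨ y ∈ x)

IsSucc : X → X → Formula X
IsSucc x y = ∀∀ λ z → z ∈ y ⇔ z ∈ x ∨ z ≐ x

Limit : X → Formula X
Limit α =
  Ordinal α ∧ (∃∃ λ β → β ∈ α) ∧ (∀∈ α λ β → ∃∈ α λ γ → β ∈ γ)

IsOmega : X → Formula X
IsOmega w = Limit w ∧ (∀∈ w λ k → ¬ Limit k)

_∈ω : X → Formula X
i ∈ω = ∃∃ λ w → IsOmega w ∧ i ∈ w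

IsNumeral : ℕ → X → Formula X
IsNumeral 0ℕ     x = IsEmpty x
IsNumeral (1+ k) x = ∃∃ λ y → IsNumeral k y ∧ IsSucc y x

Countable : X → Formula X
Countable a = ∃∃ λ w → IsOmega w ∧ (∃∃ λ f → Injection f a w)

IsOmega₁ : X → Formula X
IsOmega₁ w = Ordinal w ∧ ¬ Countable w ∧ (∀∈ w λ α → Countable α)

Cardinal : X → Formula X
Cardinal κ = Ordinal κ ∧ (∀∈ κ λ α → ¬ (∃∃ λ f → Bijection f α κ))

HasCardinality : X → X → Formula X
HasCardinality a κ = Cardinal κ ∧ (∃∃ λ f → Bijection f a κ)

Regular : X → Formula X
Regular θ =
  Cardinal θ ∧ (∀∀ λ w → IsOmega w ⇒ w ⊆ θ) ∧
  (∀∈ θ λ α → ∀∀ λ f → f ∶ α ⟶ θ ⇒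
    (∃∈ θ λ β → ∀∀ λ x → ∀∀ λ y → ⟨ x , y ⟩∈ f ⇒ y ∈ β))

IsTransitiveClosure : X → X → Formula X
IsTransitiveClosure x t =
  x ⊆ t ∧ Transitive t ∧ (∀∀ λ u → x ⊆ u ⇒ Transitive u ⇒ t ⊆ u)

_∈H_ : X → X → Formula X
x ∈H θ =
  ∃∃ λ t → IsTransitiveClosure x t ∧ (∃∈ θ λ κ → HasCardinality t κ)

Club : X → X → Formula X
Club w C =
  C ⊆ w ∧ (∀∈ w λ α → ∃∈ C λ β → α ∈ β) ∧
  (∀∈ w λ α → Limit α ⇒ (∀∈ α λ β → ∃∈ C λ γ → β ∈ γ ∧ γ ∈ α) ⇒ α ∈ C)

Stationary : X → Class X → Formula X
Stationary w S = ∀∀ λ C → Club w C ⇒ ∃∈ C S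

Extensionality Foundation Pairing Union Infinity PowerSet Choice : Formula X

Extensionality =
  ∀∀ λ x → ∀∀ λ y → (∀∀ λ z → z ∈ x ⇔ z ∈ y) ⇒ x ≐ y

Foundation =
  ∀∀ λ x → (∃∃ λ y → y ∈ x) ⇒ (∃∈ x λ y → ∀∈ y λ z → ¬ (z ∈ x))

Pairing = ∀∀ λ x → ∀∀ λ y → ∃∃ λ z → z ≐｛ x , y ｝

Union = ∀∀ λ a → ∃∃ λ u → ∀∀ λ x → x ∈ u ⇔ (∃∈ a λ y → x ∈ y)

Infinity =
  ∃∃ λ w → (∃∈ w λ x → IsEmpty x) ∧ (∀∈ w λ x → ∃∈ w λ y → IsSucc x y)

PowerSet = ∀∀ λ a → ∃∃ λ u → ∀∀ λ x → x ∈ u ⇔ x ⊆ a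

Choice =
  ∀∀ λ a → (∀∈ a λ x → ∃∃ λ y → y ∈ x) ⇒
  (∃∃ λ f → FunctionOn f a ∧ (∀∀ λ x → ∀∀ λ y → ⟨ x , y ⟩∈ f ⇒ y ∈ x))

-- One instance of a scheme, with the quantifiers restricted to D.

Separation : Class X → Class X → Formula X
Separation D φ =
  ∀∀ λ a → D a ⇒ (∃∃ λ b → D b ∧ (∀∀ λ x → D x ⇒ (x ∈ b ⇔ x ∈ a ∧ φ x)))

Replacement : Class X → (X → Class X) → Formula X
Replacement D φ =
  ∀∀ λ a → D a ⇒
  (∀∀ λ x → D x ⇒ x ∈ a ⇒ (∃! λ y → D y ∧ φ x y)) ⇒
  (∃∃ λ b → D b ∧
    (∀∀ λ x → D x ⇒ x ∈ a ⇒ (∃∃ λ y → D y ∧ y ∈ b ∧ φ x y)))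

record ZFCModel ℓ : Set (suc ℓ) where
  infix 1 ⊨_
  field
    Carrier : Set ℓ
    E       : Carrier → Carrier → Set ℓ

  ⊨_ : Formula Carrier → Set ℓ
  ⊨ φ = E ⊧ φ

  field
    extensionality : ⊨ Extensionality
    foundation     : ⊨ Foundation
    pairing        : ⊨ Pairing
    union          : ⊨ Union
    infinity       : ⊨ Infinity
    powerSet       : ⊨ PowerSet
    choice         : ⊨ Choice
    separation     : ∀ {n} (φ : Fml (1+ n)) (ρ : Vec Carrier n) →
                     ⊨ Separation (λ _ → ⊤) (λ x → φ ⟪ x ∷ ρ ⟫)
    replacement    : ∀ {n} (φ : Fml (1+ 1+ n)) (ρ : Vec Carrier n) →
                     ⊨ Replacement (λ _ → ⊤) (λ x y → φ ⟪ x ∷ y ∷ ρ ⟫)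

-- ⟨ M ,∈⟩ is an {∈}-structure and ⟨ M ,∈, P ⟩ an {∈,P̃}-structure.  Only
-- transitive structures occur, so the membership relation is the true one.
-- When a structure ⟨ M ,∈, P ⟩ has to be an element of a set, it is coded
-- as the ordered pair of M and P.

data Structure (X : Set ℓ) : Set ℓ where
  ⟨_,∈⟩   : X → Structure X
  ⟨_,∈,_⟩ : X → X → Structure X

∣_∣ : Structure X → X
∣ ⟨ M ,∈⟩ ∣     = M
∣ ⟨ M ,∈, P ⟩ ∣ = M

TransitiveStructure : Structure X → Formula X
TransitiveStructure ⟨ M ,∈⟩     = Transitive M
TransitiveStructure ⟨ M ,∈, P ⟩ = Transitive M ∧ P ⊆ M

-- Object-language formulas are coded as sets ⟨k,⟨a,b⟩⟩ with k a numeral: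
--   ⟨0,i,j⟩  vᵢ ∈ vⱼ        ⟨3,φ,φ⟩  ¬ φ
--   ⟨1,i,j⟩  vᵢ = vⱼ        ⟨4,φ,ψ⟩  φ ∧ ψ
--   ⟨2,i,i⟩  P̃ vᵢ           ⟨5,i,φ⟩  ∃ vᵢ φ

IsCode : ℕ → X → X → X → Formula X
IsCode k a b c =
  ∃∃ λ t → ∃∃ λ d → IsNumeral k t ∧ (d ≐⟨ a , b ⟩) ∧ (c ≐⟨ t , d ⟩)

HasPredicateAtoms : Structure X → X → Formula X
HasPredicateAtoms ⟨ M ,∈⟩     F = ⊤
HasPredicateAtoms ⟨ M ,∈, P ⟩ F =
  ∀∀ λ i → ∀∀ λ c → i ∈ω ⇒ IsCode 2 i i c ⇒ c ∈ F

ClosedUnderFormation : Structure X → X → Formula X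
ClosedUnderFormation 𝔐 F =
  (∀∀ λ i → ∀∀ λ j → ∀∀ λ c → i ∈ω ⇒ j ∈ω ⇒
    IsCode 0 i j c ∨ IsCode 1 i j c ⇒ c ∈ F) ∧
  HasPredicateAtoms 𝔐 F ∧
  (∀∈ F λ φ → ∀∀ λ c → IsCode 3 φ φ c ⇒ c ∈ F) ∧
  (∀∈ F λ φ → ∀∈ F λ ψ → ∀∀ λ c → IsCode 4 φ ψ c ⇒ c ∈ F) ∧
  (∀∀ λ i → ∀∈ F λ φ → ∀∀ λ c → i ∈ω ⇒ IsCode 5 i φ c ⇒ c ∈ F)

IsFormula : Structure X → X → Formula X
IsFormula 𝔐 φ = ∀∀ λ F → ClosedUnderFormation 𝔐 F ⇒ φ ∈ F

-- Assignments are partial functions from ω to M, so that the empty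
-- structure, the first level of the constructible hierarchy, has one.  An
-- atom with an unassigned variable counts as false.

IsAssignment : X → X → Formula X
IsAssignment M s =
  (∀∈ s λ z → ∃∃ λ i → ∃∈ M λ x → i ∈ω ∧ (z ≐⟨ i , x ⟩)) ∧
  (∀∀ λ i → ∀∀ λ x → ∀∀ λ y → ⟨ i , x ⟩∈ s ⇒ ⟨ i , y ⟩∈ s ⇒ x ≐ y)

-- t = s[i ↦ x]

IsUpdate : X → X → X → X → Formula X
IsUpdate s i x t =
  ∀∀ λ z → z ∈ t ⇔
    ((z ≐⟨ i , x ⟩) ∨ (z ∈ s ∧ ¬ (∃∃ λ y → z ≐⟨ i , y ⟩)))

PredicateClause : Structure X → X → X → Formula X
PredicateClause ⟨ M ,∈⟩     S s = ⊤
PredicateClause ⟨ M ,∈, P ⟩ S s =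
  ∀∀ λ i → ∀∀ λ c → i ∈ω ⇒ IsCode 2 i i c ⇒
    (⟨ c , s ⟩∈ S ⇔ (∃∃ λ x → (⟨ i , x ⟩∈ s) ∧ x ∈ P))

-- Tarski's clauses for the set S of all ⟨φ,s⟩ with 𝔐 ⊨ φ[s].

IsSatisfaction : Structure X → X → Formula X
IsSatisfaction 𝔐 S =
  ∀∀ λ s → IsAssignment ∣ 𝔐 ∣ s ⇒
    ((∀∀ λ i → ∀∀ λ j → ∀∀ λ c → i ∈ω ⇒ j ∈ω ⇒ IsCode 0 i j c ⇒
       (⟨ c , s ⟩∈ S ⇔
         (∃∃ λ x → ∃∃ λ y → (⟨ i , x ⟩∈ s) ∧ (⟨ j , y ⟩∈ s) ∧ x ∈ y))) ∧
     (∀∀ λ i → ∀∀ λ j → ∀∀ λ c → i ∈ω ⇒ j ∈ω ⇒ IsCode 1 i j c ⇒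
       (⟨ c , s ⟩∈ S ⇔
         (∃∃ λ x → ∃∃ λ y → (⟨ i , x ⟩∈ s) ∧ (⟨ j , y ⟩∈ s) ∧ x ≐ y))) ∧
     PredicateClause 𝔐 S s ∧
     (∀∀ λ φ → ∀∀ λ c → IsFormula 𝔐 φ ⇒ IsCode 3 φ φ c ⇒
       (⟨ c , s ⟩∈ S ⇔ ¬ (⟨ φ , s ⟩∈ S))) ∧
     (∀∀ λ φ → ∀∀ λ ψ → ∀∀ λ c →
       IsFormula 𝔐 φ ⇒ IsFormula 𝔐 ψ ⇒ IsCode 4 φ ψ c ⇒
       (⟨ c , s ⟩∈ S ⇔ (⟨ φ , s ⟩∈ S) ∧ (⟨ ψ , s ⟩∈ S))) ∧
     (∀∀ λ i → ∀∀ λ φ → ∀∀ λ c →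
       i ∈ω ⇒ IsFormula 𝔐 φ ⇒ IsCode 5 i φ c ⇒
       (⟨ c , s ⟩∈ S ⇔
         (∃∈ ∣ 𝔐 ∣ λ x → ∃∃ λ t → IsUpdate s i x t ∧ (⟨ φ , t ⟩∈ S)))))

_⊨_[_] : Structure X → X → X → Formula X
𝔐 ⊨ φ [ s ] = ∃∃ λ S → IsSatisfaction 𝔐 S ∧ (⟨ φ , s ⟩∈ S)

_⊨_[_,0↦_] : Structure X → X → X → X → Formula X
𝔐 ⊨ φ [ s ,0↦ x ] =
  ∃∃ λ i → ∃∃ λ t → IsNumeral 0 i ∧ IsUpdate s i x t ∧ (𝔐 ⊨ φ [ t ])

_⊨_[_,0↦_,1↦_] : Structure X → X → X → X → X → Formula X
𝔐 ⊨ φ [ s ,0↦ x ,1↦ y ] =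
  ∃∃ λ i → ∃∃ λ t → IsNumeral 1 i ∧ IsUpdate s i y t ∧ (𝔐 ⊨ φ [ t ,0↦ x ])

-- ZF and ZFC without Power Set, for a transitive structure, with the
-- schemes for all formulas in the language of the structure.

_⊨ZF⁻ _⊨ZFC⁻ : Structure X → Formula X

𝔐 ⊨ZF⁻ =
  ((Extensionality ∧ Foundation ∧ Pairing ∧ Union ∧ Infinity) ^ ∣ 𝔐 ∣) ∧
  (∀∀ λ φ → ∀∀ λ s → IsFormula 𝔐 φ ⇒ IsAssignment ∣ 𝔐 ∣ s ⇒
    Separation (λ x → x ∈ ∣ 𝔐 ∣) (λ x → 𝔐 ⊨ φ [ s ,0↦ x ]) ∧
    Replacement (λ x → x ∈ ∣ 𝔐 ∣) (λ x y → 𝔐 ⊨ φ [ s ,0↦ x ,1↦ y ]))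

𝔐 ⊨ZFC⁻ = (𝔐 ⊨ZF⁻) ∧ (Choice ^ ∣ 𝔐 ∣)

-- t = σ ∘ s

IsComposite : X → X → X → Formula X
IsComposite σ s t =
  ∀∀ λ z → z ∈ t ⇔
    (∃∃ λ i → ∃∃ λ x → ∃∃ λ y →
      (⟨ i , x ⟩∈ s) ∧ (⟨ x , y ⟩∈ σ) ∧ (z ≐⟨ i , y ⟩))

_∶_≺_ : X → Structure X → Structure X → Formula X
σ ∶ 𝔐 ≺ 𝔑 =
  (σ ∶ ∣ 𝔐 ∣ ⟶ ∣ 𝔑 ∣) ∧
  (∀∀ λ φ → ∀∀ λ s → ∀∀ λ t →
    IsFormula 𝔐 φ ⇒ IsAssignment ∣ 𝔐 ∣ s ⇒ IsComposite σ s t ⇒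
    ((𝔐 ⊨ φ [ s ]) ⇔ (𝔑 ⊨ φ [ t ])))

_∈Hull[_]_ : X → Structure X → Class X → Formula X
x ∈Hull[ 𝔐 ] C =
  x ∈ ∣ 𝔐 ∣ ∧
  (∃∃ λ φ → ∃∃ λ s →
    IsFormula 𝔐 φ ∧ IsAssignment ∣ 𝔐 ∣ s ∧
    (∀∀ λ i → ∀∀ λ y → ⟨ i , y ⟩∈ s ⇒ C y) ∧
    (∀∈ ∣ 𝔐 ∣ λ y → (𝔐 ⊨ φ [ s ,0↦ y ]) ⇔ y ≐ x))

-- D is the set of subsets of 𝔐 definable over 𝔐 with parameters.

IsDef : Structure X → X → Formula X
IsDef 𝔐 D =
  ∀∀ λ x → x ∈ D ⇔
    (∃∃ λ φ → ∃∃ λ s → IsFormula 𝔐 φ ∧ IsAssignment ∣ 𝔐 ∣ s ∧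
      (∀∀ λ y → y ∈ x ⇔ y ∈ ∣ 𝔐 ∣ ∧ (𝔐 ⊨ φ [ s ,0↦ y ])))

-- M = L_χ[A]; F is the sequence of the L_α[A] with α ≤ χ.

IsL[_] : X → X → X → Formula X
IsL[ A ] χ M =
  ∃∃ λ F → ∃∃ λ d → IsSucc χ d ∧ FunctionOn F d ∧ (⟨ χ , M ⟩∈ F) ∧
  (∀∀ λ α → ∀∀ λ v → ⟨ α , v ⟩∈ F ⇒
    (IsEmpty α ⇒ IsEmpty v) ∧
    (∀∀ λ β → ∀∀ λ u → ∀∀ λ B →
      IsSucc β α ⇒ ⟨ β , u ⟩∈ F ⇒ B ≐ A ∩ u ⇒ IsDef ⟨ u ,∈, B ⟩ v) ∧
    (Limit α ⇒
      (∀∀ λ x → x ∈ v ⇔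
        (∃∈ α λ β → ∃∃ λ u → (⟨ β , u ⟩∈ F) ∧ x ∈ u))))

-- ⟨ M ,∈, B ⟩ is the structure L^A_χ.

IsLStructure : X → X → X → X → Formula X
IsLStructure A χ M B = Ordinal χ ∧ IsL[ A ] χ M ∧ (B ≐ A ∩ M)

IsFull : X → X → Formula X
IsFull U T =
  ∃∃ λ N → Transitive N ∧ (⟨ N ,∈⟩ ⊨ZF⁻) ∧ (⟨ U , T ⟩∈ N) ∧
    (∀∈ U λ x → ∀∈ N λ f → f ∶ x ⟶ U ⇒ f ∈ U)

IsFullModel : X → X → Formula X
IsFullModel U T =
  TransitiveStructure ⟨ U ,∈, T ⟩ ∧ (⟨ U ,∈, T ⟩ ⊨ZFC⁻) ∧ IsFull U T

IsAdequate : X → Formula X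
IsAdequate K =
  ∃∃ λ ω₁ → IsOmega₁ ω₁ ∧ FunctionOn K ω₁ ∧
  (∀∀ λ ξ → ∀∀ λ k → ⟨ ξ , k ⟩∈ K ⇒
    Transitive k ∧ (⟨ k ,∈⟩ ⊨ZFC⁻) ∧ ξ ∈ k ∧ (Countable ξ ^ k)) ∧
  (∀∀ λ B → B ⊆ ω₁ ⇒
    Stationary ω₁ λ ξ →
      ξ ∈ ω₁ ∧
      (∃∃ λ k → ∃∃ λ b → (⟨ ξ , k ⟩∈ K) ∧ (b ≐ B ∩ ξ) ∧ b ∈ k))

-- k = K(ω₁^U).  In particular ω₁^U exists and lies in the domain of K.

IsAtOmega₁ : X → X → X → Formula X
IsAtOmega₁ K U k = ∃∈ U λ ξ → (IsOmega₁ ξ ^ U) ∧ (⟨ ξ , k ⟩∈ K)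

IsGood : X → X → X → Formula X
IsGood K U T =
  IsFullModel U T ∧
  (∃∃ λ k → IsAtOmega₁ K U k ∧ (⟨ U , T ⟩∈ k) ∧ (Countable U ^ k))

record Poset (X : Set ℓ) : Set ℓ where
  constructor poset
  field
    carrier order top : X

open Poset

∀Poset ∃Poset : (Poset X → Formula X) → Formula X
∀Poset φ = ∀∀ λ Q → ∀∀ λ R → ∀∀ λ 𝟙 → φ (poset Q R 𝟙)
∃Poset φ = ∃∃ λ Q → ∃∃ λ R → ∃∃ λ 𝟙 → φ (poset Q R 𝟙)

_codes_ : X → Poset X → Formula X
P codes ℙ =
  ∃∃ λ d → (d ≐⟨ order ℙ , top ℙ ⟩) ∧ (P ≐⟨ carrier ℙ , d ⟩)

_≤[_]_ : X → Poset X → X → Formula X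
q ≤[ ℙ ] p = ⟨ q , p ⟩∈ order ℙ

Compatible : Poset X → X → X → Formula X
Compatible ℙ p q = ∃∈ (carrier ℙ) λ r → (r ≤[ ℙ ] p) ∧ (r ≤[ ℙ ] q)

IsForcingNotion : Poset X → Formula X
IsForcingNotion ℙ =
  (∀∈ R λ z → ∃∈ Q λ p → ∃∈ Q λ q → z ≐⟨ p , q ⟩) ∧
  (∀∈ Q λ p → p ≤[ ℙ ] p) ∧
  (∀∀ λ p → ∀∀ λ q → ∀∀ λ r →
    p ≤[ ℙ ] q ⇒ q ≤[ ℙ ] r ⇒ p ≤[ ℙ ] r) ∧
  top ℙ ∈ Q ∧ (∀∈ Q λ p → p ≤[ ℙ ] top ℙ) ∧
  (∀∈ Q λ p → ∀∈ Q λ q → ¬ (p ≤[ ℙ ] q) ⇒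
    (∃∈ Q λ r → (r ≤[ ℙ ] p) ∧ ¬ Compatible ℙ r q))
  where
  Q = carrier ℙ
  R = order ℙ

Dense : Poset X → X → Formula X
Dense ℙ D =
  D ⊆ carrier ℙ ∧ (∀∈ (carrier ℙ) λ p → ∃∈ D λ q → q ≤[ ℙ ] p)

Filter : Poset X → X → Formula X
Filter ℙ G =
  G ⊆ carrier ℙ ∧ (∃∃ λ p → p ∈ G) ∧
  (∀∈ G λ p → ∀∈ (carrier ℙ) λ q → p ≤[ ℙ ] q ⇒ q ∈ G) ∧
  (∀∈ G λ p → ∀∈ G λ q → ∃∈ G λ r → (r ≤[ ℙ ] p) ∧ (r ≤[ ℙ ] q))

GenericOver : X → Poset X → X → Formula X
GenericOver M ℙ G =
  Filter ℙ G ∧ (∀∈ M λ D → Dense ℙ D ⇒ (∃∈ D λ p → p ∈ G))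

IsDensity : Poset X → X → Formula X
IsDensity ℙ δ =
  (∃∃ λ D → Dense ℙ D ∧ HasCardinality D δ) ∧
  (∀∀ λ D → ∀∀ λ κ → Dense ℙ D ⇒ HasCardinality D κ ⇒ δ ∈ κ ∨ δ ≐ κ)

-- Every element of T is a set of pairs ⟨y,p⟩ with y in T and p in ℙ.

NameClosed : Poset X → X → Formula X
NameClosed ℙ T =
  ∀∈ T λ x → ∀∈ x λ w → ∃∈ T λ y → ∃∈ (carrier ℙ) λ p → w ≐⟨ y , p ⟩

IsName : Poset X → X → Formula X
IsName ℙ x = ∃∃ λ T → NameClosed ℙ T ∧ x ∈ T

-- The recursion for forcing of atomic formulas, restricted to names in T:
-- I is the set of ⟨p,x,y⟩ with p ⊩ x = y, and J of those with p ⊩ x ∈ y.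
--   p ⊩ x = y  iff  q ⊩ c ∈ x ⇔ q ⊩ c ∈ y  for c ∈ dom x ∪ dom y, q ≤ p
--   p ⊩ x ∈ y  iff  {r : ∃ ⟨c,e⟩ ∈ y (r ≤ e and r ⊩ x = c)} is dense below p

AtomicForcing : Poset X → X → X → X → Formula X
AtomicForcing ℙ T I J =
  ∀∈ (carrier ℙ) λ p → ∀∈ T λ x → ∀∈ T λ y →
  (⟨ p , x , y ⟩∈ I ⇔
    (∀∀ λ c → ∀∀ λ q →
      (∃∃ λ e → (⟨ c , e ⟩∈ x) ∨ (⟨ c , e ⟩∈ y)) ⇒ q ≤[ ℙ ] p ⇒
      (⟨ q , c , x ⟩∈ J ⇔ ⟨ q , c , y ⟩∈ J))) ∧
  (⟨ p , x , y ⟩∈ J ⇔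
    (∀∀ λ q → q ≤[ ℙ ] p ⇒
      (∃∃ λ r → ∃∃ λ c → ∃∃ λ e →
        (r ≤[ ℙ ] q) ∧ (⟨ c , e ⟩∈ y) ∧ (r ≤[ ℙ ] e) ∧
        (⟨ r , x , c ⟩∈ I))))

ForcesEq ForcesIn : Poset X → X → X → X → Formula X

ForcesEq ℙ p x y =
  ∃∃ λ T → ∃∃ λ I → ∃∃ λ J → NameClosed ℙ T ∧ x ∈ T ∧ y ∈ T ∧
  AtomicForcing ℙ T I J ∧ (⟨ p , x , y ⟩∈ I)

ForcesIn ℙ p x y =
  ∃∃ λ T → ∃∃ λ I → ∃∃ λ J → NameClosed ℙ T ∧ x ∈ T ∧ y ∈ T ∧
  AtomicForcing ℙ T I J ∧ (⟨ p , x , y ⟩∈ J)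

Forces : Poset X → X → Formula X → Formula X
Forces ℙ p (x ∈ y) = ForcesIn ℙ p x y
Forces ℙ p (x ≐ y) = ForcesEq ℙ p x y
Forces ℙ p ⊥       = ⊥
Forces ℙ p (φ ∧ ψ) = Forces ℙ p φ ∧ Forces ℙ p ψ
Forces ℙ p (φ ∨ ψ) =
  ∀∀ λ q → q ≤[ ℙ ] p ⇒
    (∃∃ λ r → (r ≤[ ℙ ] q) ∧ (Forces ℙ r φ ∨ Forces ℙ r ψ))
Forces ℙ p (φ ⇒ ψ) =
  ∀∀ λ q → q ≤[ ℙ ] p ⇒ Forces ℙ q φ ⇒ Forces ℙ q ψ
Forces ℙ p (∀∀ φ)  = ∀∀ λ x → IsName ℙ x ⇒ Forces ℙ p (φ x)
Forces ℙ p (∃∃ φ)  =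
  ∀∀ λ q → q ≤[ ℙ ] p ⇒
    (∃∃ λ r → ∃∃ λ x → (r ≤[ ℙ ] q) ∧ IsName ℙ x ∧ Forces ℙ r (φ x))

-- m is the check name of x: it is {⟨y̌,𝟙⟩ : y ∈ x}, recursively.

IsCheckName : Poset X → X → X → Formula X
IsCheckName ℙ x m =
  ∃∃ λ T → ∃∃ λ F →
  Transitive T ∧ x ∈ T ∧ FunctionOn F T ∧ (⟨ x , m ⟩∈ F) ∧
  (∀∀ λ u → ∀∀ λ v → ⟨ u , v ⟩∈ F ⇒
    (∀∀ λ w → w ∈ v ⇔
      (∃∈ u λ u′ → ∃∃ λ v′ → (⟨ u′ , v′ ⟩∈ F) ∧ (w ≐⟨ v′ , top ℙ ⟩))))

check : Poset X → X → Class X → Formula X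
check ℙ x φ = ∃∃ λ x̌ → IsCheckName ℙ x x̌ ∧ φ x̌

-- The canonical name {⟨p̌,p⟩ : p ∈ ℙ} for the generic filter.

IsGenericName : Poset X → X → Formula X
IsGenericName ℙ Γ =
  ∀∀ λ w → w ∈ Γ ⇔
    (∃∈ (carrier ℙ) λ p → ∃∃ λ p̌ → IsCheckName ℙ p p̌ ∧ (w ≐⟨ p̌ , p ⟩))

-- In both definitions c̄ and c are the pairs ⟨P̄,b̄⟩ and ⟨P,b⟩, the structure
-- M̄ is ⟨ U ,∈, T ⟩, and L^A_χ is ⟨ M ,∈, B ⟩.

-- σ* is an elementary embedding of 𝔐̄ in 𝔐 with σ*(c̄) = c and σ*[Ḡ] ⊆ G.

IsLift : Structure X → Structure X → X → X → X → X → X → Formula X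
IsLift 𝔐̄ 𝔐 c̄ c Ḡ G σ* =
  (σ* ∶ 𝔐̄ ≺ 𝔐) ∧ (⟨ c̄ , c ⟩∈ σ*) ∧
  (∀∈ Ḡ λ x → ∀∀ λ y → ⟨ x , y ⟩∈ σ* ⇒ y ∈ G)

-- Hull^𝔐(δ ∪ ran σ*) = Hull^𝔐(δ ∪ ran σ)

SameHull : Structure X → X → X → X → Formula X
SameHull 𝔐 δ σ* σ =
  ∀∀ λ x → x ∈Hull[ 𝔐 ] (δ∪ran σ*) ⇔ x ∈Hull[ 𝔐 ] (δ∪ran σ)
  where
  δ∪ran : _ → Class _
  δ∪ran τ y = y ∈ δ ∨ (∃∃ λ x → ⟨ x , y ⟩∈ τ)

H_⊆_ : X → X → Formula X
H θ ⊆ M = ∀∀ λ x → x ∈H θ ⇒ x ∈ M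

_∈ran_ : X → X → Formula X
a ∈ran σ = ∃∃ λ x → ⟨ x , a ⟩∈ σ

VerifiesSubcompleteness : X → X → Poset X → Formula X
VerifiesSubcompleteness θ a ℙ =
  Regular θ ∧ a ∈H θ ∧
  (∃∃ λ P → (P codes ℙ) ∧ P ∈H θ ∧
    (∀∀ λ A → ∀∀ λ χ → ∀∀ λ M → ∀∀ λ B →
     ∀∀ λ U → ∀∀ λ T → ∀∀ λ P̄ → ∀∀ λ b̄ → ∀∀ λ c̄ →
     ∀∀ λ σ → ∀∀ λ b → ∀∀ λ c → ∀∀ λ Ḡ →
      IsLStructure A χ M B ⇒ H θ ⊆ M ⇒ ⟨ M ,∈, B ⟩ ⊨ZFC⁻ ⇒
      Countable U ⇒ IsFullModel U T ⇒ P̄ ∈ U ⇒ b̄ ∈ U ⇒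
      σ ∶ ⟨ U ,∈, T ⟩ ≺ ⟨ M ,∈, B ⟩ ⇒ a ∈ran σ ⇒
      c̄ ≐⟨ P̄ , b̄ ⟩ ⇒ c ≐⟨ P , b ⟩ ⇒ ⟨ c̄ , c ⟩∈ σ ⇒
      (∃Poset λ ℙ̄ → (P̄ codes ℙ̄) ∧ GenericOver U ℙ̄ Ḡ) ⇒
      (∃∈ (carrier ℙ) λ p* → ∃∃ λ δ → IsDensity ℙ δ ∧
       (check ℙ U λ Ǔ → check ℙ T λ Ť → check ℙ M λ M̌ → check ℙ B λ B̌ →
        check ℙ c̄ λ c̄̌ → check ℙ c λ č → check ℙ Ḡ λ Ḡ̌ →
        check ℙ δ λ δ̌ → check ℙ σ λ σ̌ →
        ∃∃ λ Γ → IsGenericName ℙ Γ ∧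
        Forces ℙ p* (∃∃ λ σ* →
          IsLift ⟨ Ǔ ,∈, Ť ⟩ ⟨ M̌ ,∈, B̌ ⟩ c̄̌ č Ḡ̌ Γ σ* ∧
          SameHull ⟨ M̌ ,∈, B̌ ⟩ δ̌ σ* σ̌)))))

VerifiesKSubcompleteness : X → X → X → Poset X → Formula X
VerifiesKSubcompleteness K θ a ℙ =
  Regular θ ∧ a ∈H θ ∧
  (∃∃ λ P → (P codes ℙ) ∧ P ∈H θ ∧
    (∀∀ λ A → ∀∀ λ χ → ∀∀ λ M → ∀∀ λ B →
     ∀∀ λ U → ∀∀ λ T → ∀∀ λ P̄ → ∀∀ λ b̄ → ∀∀ λ c̄ →
     ∀∀ λ σ → ∀∀ λ b → ∀∀ λ c → ∀∀ λ Ḡ →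
      IsLStructure A χ M B ⇒ H θ ⊆ M ⇒ ⟨ M ,∈, B ⟩ ⊨ZFC⁻ ⇒
      IsGood K U T ⇒ P̄ ∈ U ⇒ b̄ ∈ U ⇒
      σ ∶ ⟨ U ,∈, T ⟩ ≺ ⟨ M ,∈, B ⟩ ⇒ a ∈ran σ ⇒
      c̄ ≐⟨ P̄ , b̄ ⟩ ⇒ c ≐⟨ P , b ⟩ ⇒ ⟨ c̄ , c ⟩∈ σ ⇒
      (∃Poset λ ℙ̄ → (P̄ codes ℙ̄) ∧ GenericOver U ℙ̄ Ḡ) ⇒
      (∃∃ λ k → IsAtOmega₁ K U k ∧ Ḡ ∈ k) ⇒
      (∃∈ (carrier ℙ) λ p* →
       (check ℙ U λ Ǔ → check ℙ T λ Ť → check ℙ M λ M̌ → check ℙ B λ B̌ →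
        check ℙ c̄ λ c̄̌ → check ℙ c λ č → check ℙ Ḡ λ Ḡ̌ →
        ∃∃ λ Γ → IsGenericName ℙ Γ ∧
        Forces ℙ p* (∃∃ λ σ* →
          IsLift ⟨ Ǔ ,∈, Ť ⟩ ⟨ M̌ ,∈, B̌ ⟩ c̄̌ č Ḡ̌ Γ σ*)))))

Subcomplete : Poset X → Formula X
Subcomplete ℙ = ∃∃ λ θ → ∃∃ λ a → VerifiesSubcompleteness θ a ℙ

KSubcomplete : X → Poset X → Formula X
KSubcomplete K ℙ = ∃∃ λ θ → ∃∃ λ a → VerifiesKSubcompleteness K θ a ℙ

ForcingAxiom : (Poset X → Formula X) → Formula X
ForcingAxiom Φ =
  ∀Poset λ ℙ → IsForcingNotion ℙ ⇒ Φ ℙ ⇒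
  (∀∀ λ 𝒟 → (∀∈ 𝒟 λ D → Dense ℙ D) ⇒
    (∃∃ λ ω₁ → IsOmega₁ ω₁ ∧ (∃∃ λ f → Injection f 𝒟 ω₁)) ⇒
    (∃∃ λ g → Filter ℙ g ∧ (∀∈ 𝒟 λ D → ∃∈ D λ p → p ∈ g)))

SCFA : Formula X
SCFA = ForcingAxiom Subcomplete

KSCFA : X → Formula X
KSCFA K = ForcingAxiom (KSubcomplete K)

{-# OPTIONS --safe #-}
module Submission where

-- The parameters verifying subcompleteness also verify K-subcompleteness: a
-- K-good model is countable in some K_ξ, hence countable, since "f injects U
-- into ω" is absolute for transitive sets; the hull condition is dropped.

open import Defs
open import Axiom.ExcludedMiddle using (ExcludedMiddle)
open import Data.Product.Base using (_×_; _,_; proj₁; proj₂)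
open import Data.Sum.Base using (inj₁; inj₂) renaming (map to ⊎-map)
open import Function.Base using (id; _∘_)
open import Level using (Level)
open import Relation.Binary.PropositionalEquality.Core using (refl)

private
  variable
    ℓ : Level

module Absoluteness {X : Set ℓ} (E : X → X → Set ℓ) {k : X}
                    (k-transitive : E ⊧ Transitive k) where

  -- Both directions travel together because implication is contravariant: passing `φ ⇒ ψ` up
  -- requires passing `φ` down.
  record Absolute (φ : Formula X) : Set ℓ where
    constructor absolute
    field
      upward   : E ⊧ (φ ^ k) → E ⊧ φ
      downward : E ⊧ φ → E ⊧ (φ ^ k)

  open Absolute public

  private
    variable
      φ ψ : Formula X
      φ̇ : X → Formula X
      a b f w x y z : X

  element : E a k → E x a → E x k
  element a∈k = k-transitive _ a∈k _

  ∈-absolute : Absolute (x ∈ y)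
  ∈-absolute = absolute id id

  ≐-absolute : Absolute (x ≐ y)
  ≐-absolute = absolute id id

  ⊥-absolute : Absolute ⊥
  ⊥-absolute = absolute id id

  infixr 6 _∧-absolute_
  infixr 5 _∨-absolute_
  infixr 4 _⇒-absolute_
  infix  3 _⇔-absolute_

  _∧-absolute_ : Absolute φ → Absolute ψ → Absolute (φ ∧ ψ)
  p ∧-absolute q = absolute
    (λ (u , v) → upward p u , upward q v)
    (λ (u , v) → downward p u , downward q v)

  _∨-absolute_ : Absolute φ → Absolute ψ → Absolute (φ ∨ ψ)
  p ∨-absolute q = absolute
    (⊎-map (upward p) (upward q)) (⊎-map (downward p) (downward q))

  _⇒-absolute_ : Absolute φ → Absolute ψ → Absolute (φ ⇒ ψ)
  p ⇒-absolute q = absolute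
    (λ h → upward q ∘ h ∘ downward p) (λ h → downward q ∘ h ∘ upward p)

  ¬-absolute : Absolute φ → Absolute (¬ φ)
  ¬-absolute p = p ⇒-absolute ⊥-absolute

  _⇔-absolute_ : Absolute φ → Absolute ψ → Absolute (φ ⇔ ψ)
  p ⇔-absolute q = (p ⇒-absolute q) ∧-absolute (q ⇒-absolute p)

  -- The second hypothesis says constructively that φ̇ holds outside k.
  ∀∀-absolute : (∀ x → E x k → Absolute (φ̇ x)) →
                (∀ x → (E x k → E ⊧ φ̇ x) → E ⊧ φ̇ x) →
                Absolute (∀∀ φ̇)
  ∀∀-absolute p guard = absolute
    (λ h x → guard x λ x∈k → upward (p x x∈k) (h x x∈k))
    (λ h x x∈k → downward (p x x∈k) (h x))

  -- Relativising demands a witness inside `k`; on the way down `bounded` puts the given one there.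
  ∃∃-absolute : (∀ x → E x k → Absolute (φ̇ x)) →
                (∀ x → E ⊧ φ̇ x → E x k) →
                Absolute (∃∃ φ̇)
  ∃∃-absolute p bounded = absolute
    (λ (x , x∈k , h) → x , upward (p x x∈k) h)
    (λ (x , h) → let x∈k = bounded x h in x , x∈k , downward (p x x∈k) h)

  -- Transitivity of `k` supplies the guard, since members of an `a` in `k` are again in `k`. With
  -- its existential twin this handles bounded quantifiers.
  ∀∈-absolute : E a k → (∀ x → E x k → Absolute (φ̇ x)) → Absolute (∀∈ a φ̇)
  ∀∈-absolute a∈k p = ∀∀-absolute
    (λ x x∈k → ∈-absolute ⇒-absolute p x x∈k)
    (λ x h x∈a → h (element a∈k x∈a) x∈a)

  ∃∈-absolute : E a k → (∀ x → E x k → Absolute (φ̇ x)) → Absolute (∃∈ a φ̇)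
  ∃∈-absolute a∈k p = ∃∃-absolute
    (λ x x∈k → ∈-absolute ∧-absolute p x x∈k)
    (λ x (x∈a , _) → element a∈k x∈a)

  Ordinal-absolute : E a k → Absolute (Ordinal a)
  Ordinal-absolute a∈k =
    (∀∈-absolute a∈k λ x x∈k → ∀∈-absolute x∈k λ y y∈k → ∈-absolute)
    ∧-absolute
    (∀∈-absolute a∈k λ x _ → ∀∈-absolute a∈k λ y _ →
      ∈-absolute ∨-absolute ≐-absolute ∨-absolute ∈-absolute)

  Limit-absolute : E a k → Absolute (Limit a)
  Limit-absolute a∈k =
    Ordinal-absolute a∈k ∧-absolute
    ∃∃-absolute (λ _ _ → ∈-absolute) (λ _ → element a∈k) ∧-absolute
    (∀∈-absolute a∈k λ _ _ → ∃∈-absolute a∈k λ _ _ → ∈-absolute)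

  -- Every quantifier is bounded by `w` or by an element of `w`, so what `k` takes for ω is the true
  -- ω.
  IsOmega-absolute : E w k → Absolute (IsOmega w)
  IsOmega-absolute w∈k =
    Limit-absolute w∈k ∧-absolute
    (∀∈-absolute w∈k λ x x∈k → ¬-absolute (Limit-absolute x∈k))

  left-∈ : E ⊧ (z ≐｛ a , b ｝) → E a z
  left-∈ h = proj₂ (h _) (inj₁ refl)

  right-∈ : E ⊧ (z ≐｛ a , b ｝) → E b z
  right-∈ h = proj₂ (h _) (inj₂ refl)

  unorderedPair-absolute : E z k → E a k → E b k → Absolute (z ≐｛ a , b ｝)
  unorderedPair-absolute z∈k a∈k b∈k = ∀∀-absolute
    (λ _ _ → ∈-absolute ⇔-absolute ≐-absolute ∨-absolute ≐-absolute)
    -- Either side of the equivalence already places `x` in `k`: as a member of `z`, or as one of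
    -- `a` and `b`.
    (λ x h → (λ x∈z → proj₁ (h (element z∈k x∈z)) x∈z) ,
             λ { (inj₁ refl) → proj₂ (h a∈k) (inj₁ refl)
               ; (inj₂ refl) → proj₂ (h b∈k) (inj₂ refl) })

  -- In a Kuratowski pair both components belong to the second member {a, b} of `z`, so transitivity
  -- is applied twice.
  components-∈ : E z k → E ⊧ (z ≐⟨ a , b ⟩) → E a k × E b k
  components-∈ z∈k (u , v , _ , v≐ , z≐) =
    let v∈k = element z∈k (right-∈ z≐)
    in  element v∈k (left-∈ v≐) , element v∈k (right-∈ v≐)

  orderedPair-absolute : E z k → E a k → E b k → Absolute (z ≐⟨ a , b ⟩)
  orderedPair-absolute z∈k a∈k b∈k = ∃∃-absolute
    (λ u u∈k → ∃∃-absolute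
      (λ v v∈k →
        unorderedPair-absolute u∈k a∈k a∈k ∧-absolute
        unorderedPair-absolute v∈k a∈k b∈k ∧-absolute
        unorderedPair-absolute z∈k u∈k v∈k)
      (λ v (_ , _ , z≐) → element z∈k (right-∈ z≐)))
    (λ u (v , _ , _ , z≐) → element z∈k (left-∈ z≐))

  pair∈-absolute : E f k → E a k → E b k → Absolute (⟨ a , b ⟩∈ f)
  pair∈-absolute f∈k a∈k b∈k =
    ∃∈-absolute f∈k λ z z∈k → orderedPair-absolute z∈k a∈k b∈k

  -- This turns the unbounded quantifiers over arguments and values of `f` into quantifiers over
  -- `k`.
  arguments-∈ : E f k → E ⊧ (⟨ a , b ⟩∈ f) → E a k × E b k
  arguments-∈ f∈k (z , z∈f , z≐) = components-∈ (element f∈k z∈f) z≐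

  FunctionOn-absolute : E f k → E a k → Absolute (FunctionOn f a)
  FunctionOn-absolute f∈k a∈k =
    (∀∈-absolute f∈k λ z z∈k → ∃∈-absolute a∈k λ x x∈k → ∃∃-absolute
      (λ y y∈k → orderedPair-absolute z∈k x∈k y∈k)
      (λ y → proj₂ ∘ components-∈ z∈k))
    ∧-absolute
    (∀∈-absolute a∈k λ x x∈k → ∃∃-absolute
      (λ y y∈k → pair∈-absolute f∈k x∈k y∈k ∧-absolute ∀∀-absolute
        (λ y′ y′∈k → pair∈-absolute f∈k x∈k y′∈k ⇒-absolute ≐-absolute)
        (λ y′ h p → h (proj₂ (arguments-∈ f∈k p)) p))
      (λ y → proj₂ ∘ arguments-∈ f∈k ∘ proj₁))

  -- The codomain occurs only in the atom `y ∈ b`, which relativisation leaves unchanged, so the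
  -- assumptions concern `f` and `a` alone.
  Injection-absolute : E f k → E a k → Absolute (Injection f a b)
  Injection-absolute f∈k a∈k =
    (FunctionOn-absolute f∈k a∈k ∧-absolute ∀∀-absolute
      (λ x x∈k → ∀∀-absolute
        (λ y y∈k → pair∈-absolute f∈k x∈k y∈k ⇒-absolute ∈-absolute)
        (λ y h p → h (proj₂ (arguments-∈ f∈k p)) p))
      (λ x h y p → h (proj₁ (arguments-∈ f∈k p)) y p))
    ∧-absolute
    ∀∀-absolute
      (λ x x∈k → ∀∀-absolute
        (λ x′ x′∈k → ∀∀-absolute
          (λ y y∈k →
            pair∈-absolute f∈k x∈k y∈k ⇒-absolute
            pair∈-absolute f∈k x′∈k y∈k ⇒-absolute ≐-absolute)
          (λ y h p → h (proj₂ (arguments-∈ f∈k p)) p))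
        -- The variable `x′` occurs only in the second membership premise, hence the guard waits for
        -- `p′`.
        (λ x′ h y p p′ → h (proj₁ (arguments-∈ f∈k p′)) y p p′))
      (λ x h x′ y p → h (proj₁ (arguments-∈ f∈k p)) x′ y p)

  -- Only this direction holds in general: an injection into ω that lies in `k` is a true one, but a
  -- true one may lie outside `k`.
  Countable-upward : E a k → E ⊧ (Countable a ^ k) → E ⊧ Countable a
  Countable-upward a∈k (w , w∈k , w-omega , f , f∈k , f-injection) =
    w , upward (IsOmega-absolute w∈k) w-omega ,
    f , upward (Injection-absolute f∈k a∈k) f-injection

good⇒countable : {X : Set ℓ} (E : X → X → Set ℓ) {K U T : X} →
                 E ⊧ IsAdequate K → E ⊧ IsGood K U T → E ⊧ Countable U
good⇒countable E (_ , _ , _ , models , _)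
                 (_ , k , (ξ , _ , _ , ξk∈K) , UT∈k , U-countable) =
  let z , z∈k , z≐ = UT∈k
  -- Goodness places the coded structure ⟨U,T⟩ in `k`; `U` itself is recovered as a component of
  -- that pair.
  in  Countable-upward (proj₁ (components-∈ z∈k z≐)) U-countable
  where
  open Absoluteness E (proj₁ (models ξ k ξk∈K))

subcomplete⇒K-subcomplete :
  {X : Set ℓ} (E : X → X → Set ℓ) {K : X} {ℙ : Poset X} →
  E ⊧ IsAdequate K → E ⊧ Subcomplete ℙ → E ⊧ KSubcomplete K ℙ
subcomplete⇒K-subcomplete E {K} adequate
  (θ , a , regular , a∈H , P , P-codes , P∈H , verify) =
  θ , a , regular , a∈H , P , P-codes , P∈H ,
  λ A χ M B U T P̄ b̄ c̄ σ b c Ḡ L H⊆M zfc good P̄∈U b̄∈U σ≺ a∈ran c̄≐ c≐ c̄c∈σ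
    generic _ →
  let countable = good⇒countable E {K} {U} {T} adequate good
      -- The skipped entries are the density δ with its defining property and the check names of δ
      -- and `σ`, all of which serve the hull clause.
      p* , p*∈ℙ , _ , _ ,
        Ǔ , iU , Ť , iT , M̌ , iM , B̌ , iB , c̄̌ , ic̄ , č , ic , Ḡ̌ , iḠ ,
        _ , _ , _ , _ , Γ , iΓ , forced =
        verify A χ M B U T P̄ b̄ c̄ σ b c Ḡ L H⊆M zfc countable (proj₁ good)
          P̄∈U b̄∈U σ≺ a∈ran c̄≐ c≐ c̄c∈σ generic
  in  p* , p*∈ℙ ,
      Ǔ , iU , Ť , iT , M̌ , iM , B̌ , iB , c̄̌ , ic̄ , č , ic , Ḡ̌ , iḠ , Γ , iΓ ,
      -- Forcing an existential is a density statement and forcing a conjunction is componentwise,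
      -- so below each `q` the same `r` and the same name `σ*` witness the weaker statement.
      λ q q≤p* → let r , σ* , r≤q , name , lift , _ = forced q q≤p*
                 in  r , σ* , r≤q , name , lift

proposition5p3 : ∀ {ℓ} → ExcludedMiddle ℓ → (𝔙 : ZFCModel ℓ) → let open ZFCModel 𝔙 in
    ⊨ (∃∃ λ K → IsAdequate K ∧ KSCFA K) ⇒ SCFA
proposition5p3 _ 𝔙 (K , adequate , K-scfa) Q R 𝟙 forcing subcomplete =
  -- `ForcingAxiom` is antitone in the class of posets, so the larger class yields the filter for
  -- the same poset and the same dense sets.
  K-scfa Q R 𝟙 forcing
    (subcomplete⇒K-subcomplete E {K} {poset Q R 𝟙} adequate subcomplete)
  where open ZFCModel 𝔙
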